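{- Let $n \geq 4$ and let $D_n = \{\pm\varepsilon_i \pm \varepsilon_j \mid 1 \leq i < j \leq n\} \subset \mathbb{R}^n$ be the root system of type $D_n$ (all four sign choices), where $\varepsilon_1,\dots,\varepsilon_n$ is the standard basis of $\mathbb{R}^n$. There exists a subset $H \subset D_n$ containing exactly one vector from each antipodal pair $\{\alpha,-\alpha\}$ of $D_n$ such that $\sum_{\alpha\in H}\alpha = \mathbf{0}$ if and only if $n \equiv 0$ or $1 \pmod 4$.
   Context: A "half" of an antipodal set of vectors means a subset containing exactly one vector from each antipodal pair $\{\alpha,-\alpha\}$. -}

module Defs where

open import Data.Nat using (ℕ)
open import Data.Fin using (Fin; _<_; _≟_)
open import Data.Integer using (ℤ; 0ℤ; 1ℤ; -1ℤ; _+_; _*_; -_)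
open import Data.Sign using (Sign)
open import Data.Vec using (Vec; tabulate; zipWith; map; replicate)
open import Data.List using (List; foldr)
open import Data.List.Membership.Propositional using (_∈_)
open import Data.List.Relation.Unary.All using (All)
open import Data.List.Relation.Unary.Unique.Propositional using (Unique)
open import Data.Product using (Σ; ∃; _×_)
open import Data.Sum using (_⊎_)
open import Relation.Nullary using (¬_; does)
open import Relation.Binary.PropositionalEquality using (_≡_)
open import Data.Bool using (if_then_else_)

-- vectors of ℝ^n with integer coordinates (all roots of D_n are integral)
ℤVec : ℕ → Set
ℤVec n = Vec ℤ n

_⊕_ : ∀ {n} → ℤVec n → ℤVec n → ℤVec n
_⊕_ = zipWith _+_

neg : ∀ {n} → ℤVec n → ℤVec n
neg = map -_

_·_ : ∀ {n} → ℤ → ℤVec n → ℤVec n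
c · v = map (c *_) v

𝟎 : ∀ {n} → ℤVec n
𝟎 = replicate _ 0ℤ

-- standard basis vector ε_i
ε : ∀ {n} → Fin n → ℤVec n
ε i = tabulate (λ k → if does (k ≟ i) then 1ℤ else 0ℤ)

sgn : Sign → ℤ
sgn Sign.+ = 1ℤ
sgn Sign.- = -1ℤ

-- v ∈ D_n : v = ±ε_i ± ε_j with i < j (all four sign choices)
InD : ∀ n → ℤVec n → Set
InD n v = Σ (Fin n) λ i → Σ (Fin n) λ j → Σ Sign λ s → Σ Sign λ t →
  (i < j) × (v ≡ (sgn s · ε i) ⊕ (sgn t · ε j))

-- a finite set of vectors represented as a duplicate-free list
vsum : ∀ {n} → List (ℤVec n) → ℤVec n
vsum = foldr _⊕_ 𝟎

-- H is a half of D_n: H ⊆ D_n, and it contains exactly one vector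
-- from each antipodal pair {α, -α} of D_n
IsHalf : ∀ n → List (ℤVec n) → Set
IsHalf n H = Unique H × All (InD n) H ×
  (∀ α → InD n α → ((α ∈ H) × ¬ (neg α ∈ H)) ⊎ ((neg α ∈ H) × ¬ (α ∈ H)))

-- A half contains exactly one root of each antipodal pair, so the sum over a half of any
-- negation-invariant weight is the same for all halves. The weight |coordinate sum| is 2 on
-- the n C 2 pairs ±(εᵢ + εⱼ) and 0 on the pairs ±(εᵢ − εⱼ), so every half has weight
-- 2·(n C 2). If a half sums to zero, so does its coordinate sum; hence as many of its roots
-- have coordinate sum +2 as −2, n C 2 is even, and n ≡ 0, 1 (mod 4).
-- Conversely, a half of D_{m+1} is a half of D_m, padded with a leading zero, together with
-- one root from each pair ±(ε₀ ± ε_{i+1}). Choosing these roots suitably in four successive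
-- extensions turns a zero-sum half of D_m into one of D_{m+4}; the empty halves of D₀ and D₁
-- start the induction.

module Submission where

open import Defs
open import Data.Nat using (ℕ; _≤_; _%_)
open import Data.List using (List)
open import Data.Product using (Σ; _×_)
open import Data.Sum using (_⊎_)
open import Function.Bundles using (_⇔_)
open import Relation.Binary.PropositionalEquality using (_≡_)

import Algebra.Properties.CommutativeSemigroup as CommSemigroupProps
open import Data.Bool using (Bool; true; false; not; if_then_else_)
open import Data.Empty using (⊥-elim)
open import Data.Fin using (Fin; zero; suc)
open import Data.Integer as ℤ using (ℤ; +_; +[1+_]; -[1+_]; 0ℤ; 1ℤ; _+_; _-_; -_; ∣_∣)
import Data.Integer.Properties as ℤ
open import Data.Integer.Tactic.RingSolver as ℤ-Solver using ()
open import Data.List as List using ([]; _∷_; _++_; map)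
import Data.List.Properties as List
open import Data.List.Membership.Propositional using (_∈_)
open import Data.List.Membership.Propositional.Properties using (∈-map⁺; ∈-map⁻; ∈-++⁺ˡ; ∈-++⁺ʳ; ∈-++⁻)
open import Data.List.Membership.Propositional.Properties.WithK using (unique∧set⇒bag)
open import Data.List.Relation.Binary.BagAndSetEquality using (∼bag⇒↭)
open import Data.List.Relation.Binary.Permutation.Propositional using (_↭_)
import Data.List.Relation.Binary.Permutation.Propositional.Properties as ↭
open import Data.List.Relation.Unary.All as All using (All; []; _∷_)
import Data.List.Relation.Unary.All.Properties as All
open import Data.List.Relation.Unary.Any using (here; there)
open import Data.List.Relation.Unary.Unique.Propositional using (Unique; []; _∷_)
import Data.List.Relation.Unary.Unique.Propositional.Properties as Unique
open import Data.Nat as ℕ using (zero; suc; _*_; s≤s; z≤n)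
open import Data.Nat.Combinatorics using (_C_; nC1≡n; nCk+nC[k+1]≡[n+1]C[k+1])
open import Data.Nat.DivMod using ([m+n]%n≡m%n)
open import Data.Nat.Divisibility using (_∣_; _∣0; ∣-refl; ∣m∣n⇒∣m+n; ∣m+n∣m⇒∣n; m∣m*n; n∣m⇒m%n≡0)
open import Data.Nat.ListAction using (sum)
open import Data.Nat.ListAction.Properties using (sum-++; sum-↭)
import Data.Nat.Properties as ℕ
open import Data.Nat.Tactic.RingSolver as ℕ-Solver using ()
open import Data.Product using (_,_; ∃₂; proj₁)
import Data.Product as Product
open import Data.Sign as Sign using (Sign; opposite)
import Data.Sign.Properties as Sign
open import Data.Sum using (inj₁; inj₂)
import Data.Sum as Sum
open import Data.Vec as Vec using (Vec; []; _∷_; tabulate; replicate; lookup)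
open import Data.Vec.Properties
  using (zipWith-identityˡ; zipWith-assoc; map-replicate; ∷-injective; ∷-injectiveˡ; ∷-injectiveʳ)
open import Function using (_∘_; id; const; case_of_)
open import Function.Bundles using (mk⇔; Equivalence)
import Function.Properties.Equivalence as ⇔
open import Relation.Binary.PropositionalEquality
  using (refl; sym; trans; cong; cong₂; subst; _≢_; module ≡-Reasoning)
open import Relation.Nullary using (¬_)

open CommSemigroupProps ℤ.+-commutativeSemigroup using () renaming (interchange to ℤ-interchange)
open CommSemigroupProps ℕ.+-commutativeSemigroup using () renaming (interchange to ℕ-interchange)

private
  variable
    m n : ℕ

⊕-identityˡ : (v : ℤVec n) → 𝟎 ⊕ v ≡ v
⊕-identityˡ = zipWith-identityˡ ℤ.+-identityˡ

⊕-assoc : (u v w : ℤVec n) → (u ⊕ v) ⊕ w ≡ u ⊕ (v ⊕ w)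
⊕-assoc = zipWith-assoc ℤ.+-assoc

·-𝟎 : ∀ c → c · 𝟎 {n} ≡ 𝟎
·-𝟎 {n} c = trans (map-replicate (c ℤ.*_) 0ℤ n) (cong (replicate n) (ℤ.*-zeroʳ c))

neg-𝟎 : neg (𝟎 {n}) ≡ 𝟎
neg-𝟎 {n} = map-replicate -_ 0ℤ n

neg-involutive : (v : ℤVec n) → neg (neg v) ≡ v
neg-involutive [] = refl
neg-involutive (x ∷ v) = cong₂ _∷_ (ℤ.neg-involutive x) (neg-involutive v)

coordSum : ℤVec n → ℤ
coordSum [] = 0ℤ
coordSum (x ∷ v) = x + coordSum v

coordSum-𝟎 : ∀ n → coordSum (𝟎 {n}) ≡ 0ℤ
coordSum-𝟎 zero = refl
coordSum-𝟎 (suc n) = cong (_+_ 0ℤ) (coordSum-𝟎 n)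

coordSum-⊕ : (u v : ℤVec n) → coordSum (u ⊕ v) ≡ coordSum u + coordSum v
coordSum-⊕ [] [] = refl
coordSum-⊕ (x ∷ u) (y ∷ v) =
  trans (cong (_+_ (x + y)) (coordSum-⊕ u v)) (ℤ-interchange x y (coordSum u) (coordSum v))

coordSum-neg : (v : ℤVec n) → coordSum (neg v) ≡ - coordSum v
coordSum-neg [] = refl
coordSum-neg (x ∷ v) = trans (cong (_+_ (- x)) (coordSum-neg v)) (sym (ℤ.neg-distrib-+ x (coordSum v)))

tabulate-const : ∀ n (x : ℤ) → tabulate {n = n} (λ _ → x) ≡ replicate n x
tabulate-const zero x = refl
tabulate-const (suc n) x = cong (x ∷_) (tabulate-const n x)

ε-zero : ε {suc n} zero ≡ 1ℤ ∷ 𝟎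
ε-zero {n} = cong (1ℤ ∷_) (tabulate-const n 0ℤ)

sgn≢0 : ∀ s → sgn s ≢ 0ℤ
sgn≢0 Sign.+ ()
sgn≢0 Sign.- ()

sgn-injective : ∀ {s t} → sgn s ≡ sgn t → s ≡ t
sgn-injective {Sign.+} {Sign.+} _ = refl
sgn-injective {Sign.-} {Sign.-} _ = refl
sgn-injective {Sign.+} {Sign.-} ()
sgn-injective {Sign.-} {Sign.+} ()

neg-sgn : ∀ s → - sgn s ≡ sgn (opposite s)
neg-sgn Sign.+ = refl
neg-sgn Sign.- = refl

±ε : Sign → Fin n → ℤVec n
±ε s zero = sgn s ∷ 𝟎
±ε s (suc i) = 0ℤ ∷ ±ε s i

sgn·ε≡±ε : ∀ s (i : Fin n) → sgn s · ε i ≡ ±ε s i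
sgn·ε≡±ε s zero = trans (cong (sgn s ·_) ε-zero) (cong₂ _∷_ (ℤ.*-identityʳ (sgn s)) (·-𝟎 (sgn s)))
sgn·ε≡±ε s (suc i) = cong₂ _∷_ (ℤ.*-zeroʳ (sgn s)) (sgn·ε≡±ε s i)

±ε-injective : ∀ {s t} {i j : Fin n} → ±ε s i ≡ ±ε t j → s ≡ t × i ≡ j
±ε-injective {i = zero} {zero} e = sgn-injective (∷-injectiveˡ e) , refl
±ε-injective {s = s} {i = zero} {suc j} e = ⊥-elim (sgn≢0 s (∷-injectiveˡ e))
±ε-injective {t = t} {i = suc i} {zero} e = ⊥-elim (sgn≢0 t (sym (∷-injectiveˡ e)))
±ε-injective {i = suc i} {suc j} e with ±ε-injective (∷-injectiveʳ e)
... | s≡t , i≡j = s≡t , cong suc i≡j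

neg-±ε : ∀ s (i : Fin n) → neg (±ε s i) ≡ ±ε (opposite s) i
neg-±ε s zero = cong₂ _∷_ (neg-sgn s) neg-𝟎
neg-±ε s (suc i) = cong (0ℤ ∷_) (neg-±ε s i)

coordSum-±ε : ∀ s (i : Fin n) → coordSum (±ε s i) ≡ sgn s
coordSum-±ε {suc n} s zero = trans (cong (_+_ (sgn s)) (coordSum-𝟎 n)) (ℤ.+-identityʳ (sgn s))
coordSum-±ε s (suc i) = trans (ℤ.+-identityˡ _) (coordSum-±ε s i)

leadRoot : Sign → Sign → Fin m → ℤVec (suc m)
leadRoot s u i = sgn s ∷ ±ε u i

leadRoot-injective : ∀ {s u s′ u′} {i j : Fin m} → leadRoot s u i ≡ leadRoot s′ u′ j → s ≡ s′ × u ≡ u′ × i ≡ j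
leadRoot-injective e with ∷-injective e
... | hd , tl = sgn-injective hd , ±ε-injective tl

neg-leadRoot : ∀ s u (i : Fin m) → neg (leadRoot s u i) ≡ leadRoot (opposite s) (opposite u) i
neg-leadRoot s u i = cong₂ _∷_ (neg-sgn s) (neg-±ε u i)

coordSum-leadRoot : ∀ s u (i : Fin m) → coordSum (leadRoot s u i) ≡ sgn s + sgn u
coordSum-leadRoot s u i = cong (_+_ (sgn s)) (coordSum-±ε u i)

leadRoot-as-sum : ∀ s u (i : Fin m) → (sgn s · ε zero) ⊕ (sgn u · ε (suc i)) ≡ leadRoot s u i
leadRoot-as-sum s u i = trans (cong₂ _⊕_ (sgn·ε≡±ε s zero) (sgn·ε≡±ε u (suc i)))
  (cong₂ _∷_ (ℤ.+-identityʳ (sgn s)) (⊕-identityˡ (±ε u i)))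

tailRoot-as-sum : ∀ s t (i j : Fin m) →
  (sgn s · ε (suc i)) ⊕ (sgn t · ε (suc j)) ≡ 0ℤ ∷ ((sgn s · ε i) ⊕ (sgn t · ε j))
tailRoot-as-sum s t i j = cong (_∷ ((sgn s · ε i) ⊕ (sgn t · ε j))) (cong₂ _+_ (ℤ.*-zeroʳ (sgn s)) (ℤ.*-zeroʳ (sgn t)))

data RootView {m} : ℤVec (suc m) → Set where
  isLead : ∀ s u i → RootView (leadRoot s u i)
  isTail : ∀ {β} → InD m β → RootView (0ℤ ∷ β)

rootView : ∀ {α} → InD (suc m) α → RootView α
rootView (zero , zero , s , t , () , _)
rootView (zero , suc j , s , t , _ , refl) = subst RootView (sym (leadRoot-as-sum s t j)) (isLead s t j)
rootView (suc i , zero , s , t , () , _)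
rootView (suc i , suc j , s , t , s≤s i<j , refl) =
  subst RootView (sym (tailRoot-as-sum s t i j)) (isTail (i , j , s , t , i<j , refl))

InD-leadRoot : ∀ s u (i : Fin m) → InD (suc m) (leadRoot s u i)
InD-leadRoot s u i = zero , suc i , s , u , s≤s z≤n , sym (leadRoot-as-sum s u i)

InD-tail : ∀ {β} → InD m β → InD (suc m) (0ℤ ∷ β)
InD-tail (i , j , s , t , i<j , refl) = suc i , suc j , s , t , s≤s i<j , sym (tailRoot-as-sum s t i j)

InD-0-empty : ∀ {α} → ¬ InD 0 α
InD-0-empty (() , _)

InD⇒≢𝟎 : ∀ {α} → InD n α → α ≢ 𝟎
InD⇒≢𝟎 {zero} d = ⊥-elim (InD-0-empty d)
InD⇒≢𝟎 {suc n} d with rootView d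
... | isLead s u i = λ e → sgn≢0 s (∷-injectiveˡ e)
... | isTail dβ = λ e → InD⇒≢𝟎 dβ (∷-injectiveʳ e)

Xor : Set → Set → Set
Xor A B = (A × ¬ B) ⊎ (B × ¬ A)

-- IsHalf n is IsHalfOf (InD n) by definition.
IsHalfOf : (ℤVec n → Set) → List (ℤVec n) → Set
IsHalfOf D H = Unique H × All D H × (∀ α → D α → Xor (α ∈ H) (neg α ∈ H))

leadsNegative : ℤVec n → Bool
leadsNegative [] = false
leadsNegative (+ 0 ∷ v) = leadsNegative v
leadsNegative (+[1+ _ ] ∷ v) = false
leadsNegative (-[1+ _ ] ∷ v) = true

leadsNegative-neg : (v : ℤVec n) → v ≢ 𝟎 → leadsNegative (neg v) ≡ not (leadsNegative v)
leadsNegative-neg [] v≢𝟎 = ⊥-elim (v≢𝟎 refl)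
leadsNegative-neg (+ 0 ∷ v) v≢𝟎 = leadsNegative-neg v (v≢𝟎 ∘ cong (+ 0 ∷_))
leadsNegative-neg (+[1+ _ ] ∷ v) _ = refl
leadsNegative-neg (-[1+ _ ] ∷ v) _ = refl

canonical : ℤVec n → ℤVec n
canonical v = if leadsNegative v then neg v else v

canonical-cases : (v : ℤVec n) → canonical v ≡ v ⊎ canonical v ≡ neg v
canonical-cases v with leadsNegative v
... | true = inj₂ refl
... | false = inj₁ refl

canonical-neg : (v : ℤVec n) → v ≢ 𝟎 → canonical (neg v) ≡ canonical v
canonical-neg v v≢𝟎 with leadsNegative v | leadsNegative-neg v v≢𝟎
... | true | e rewrite e = refl
... | false | e rewrite e = neg-involutive v

sum-map-∘ : ∀ {A B : Set} {v : A → ℕ} (w : B → ℕ) (f : A → B) → (∀ x → w (f x) ≡ v x) →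
  ∀ xs → sum (map w (map f xs)) ≡ sum (map v xs)
sum-map-∘ w f wf≡v xs = cong sum (trans (sym (List.map-∘ xs)) (List.map-cong wf≡v xs))

unique-map-injectiveOn : ∀ {A B : Set} (f : A → B) {xs} →
  (∀ {x y} → x ∈ xs → y ∈ xs → f x ≡ f y → x ≡ y) → Unique xs → Unique (map f xs)
unique-map-injectiveOn f inj [] = []
unique-map-injectiveOn f inj (x≢xs ∷ u) =
  All.map⁺ (All.tabulate λ y∈ fx≡fy → All.lookup x≢xs y∈ (inj (here refl) (there y∈) fx≡fy))
  ∷ unique-map-injectiveOn f (λ x∈ y∈ → inj (there x∈) (there y∈)) u

module _ {D : ℤVec n → Set} where

  private
    variable
      H K : List (ℤVec n)

  half-antipodal-free : IsHalfOf D H → ∀ {x} → x ∈ H → ¬ (neg x ∈ H)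
  half-antipodal-free (_ , H⊆D , complete) {x} x∈H with complete x (All.lookup H⊆D x∈H)
  ... | inj₁ (_ , -x∉H) = -x∉H
  ... | inj₂ (_ , x∉H) = ⊥-elim (x∉H x∈H)

  canonical-injectiveOn : IsHalfOf D H → ∀ {x y} → x ∈ H → y ∈ H → canonical x ≡ canonical y → x ≡ y
  canonical-injectiveOn half {x} {y} x∈H y∈H e with canonical-cases x | canonical-cases y
  ... | inj₁ cx | inj₁ cy = trans (sym cx) (trans e cy)
  ... | inj₁ cx | inj₂ cy = ⊥-elim (half-antipodal-free half y∈H (subst (_∈ _) (trans (sym cx) (trans e cy)) x∈H))
  ... | inj₂ cx | inj₁ cy = ⊥-elim (half-antipodal-free half x∈H (subst (_∈ _) (trans (sym cy) (trans (sym e) cx)) y∈H))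
  ... | inj₂ cx | inj₂ cy =
    trans (sym (neg-involutive x)) (trans (cong neg (trans (sym cx) (trans e cy))) (neg-involutive y))

  module _ (D-nonzero : ∀ {α} → D α → α ≢ 𝟎) where

    canonical-⊆ : IsHalfOf D H → IsHalfOf D K → ∀ {z} → z ∈ map canonical H → z ∈ map canonical K
    canonical-⊆ (_ , H⊆D , _) (_ , _ , completeK) z∈ with ∈-map⁻ canonical z∈
    ... | x , x∈H , refl with All.lookup H⊆D x∈H
    ... | Dx with completeK x Dx
    ... | inj₁ (x∈K , _) = ∈-map⁺ canonical x∈K
    ... | inj₂ (-x∈K , _) = subst (_∈ _) (canonical-neg x (D-nonzero Dx)) (∈-map⁺ canonical -x∈K)

    canonical-↭ : IsHalfOf D H → IsHalfOf D K → map canonical H ↭ map canonical K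
    canonical-↭ hH hK = ∼bag⇒↭ (unique∧set⇒bag
      (unique-map-injectiveOn canonical (canonical-injectiveOn hH) (proj₁ hH))
      (unique-map-injectiveOn canonical (canonical-injectiveOn hK) (proj₁ hK))
      (mk⇔ (canonical-⊆ hH hK) (canonical-⊆ hK hH)))

    half-weight-invariant : (w : ℤVec n → ℕ) → (∀ v → w (neg v) ≡ w v) → ∀ {H K} →
      IsHalfOf D H → IsHalfOf D K → sum (map w H) ≡ sum (map w K)
    half-weight-invariant w w-neg {H} {K} hH hK = begin
      sum (map w H)                   ≡⟨ sum-map-∘ w canonical w-canonical H ⟨
      sum (map w (map canonical H))   ≡⟨ sum-↭ (↭.map⁺ w (canonical-↭ hH hK)) ⟩
      sum (map w (map canonical K))   ≡⟨ sum-map-∘ w canonical w-canonical K ⟩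
      sum (map w K)                   ∎
      where
      open ≡-Reasoning
      w-canonical : ∀ v → w (canonical v) ≡ w v
      w-canonical v with canonical-cases v
      ... | inj₁ e = cong w e
      ... | inj₂ e = trans (cong w e) (w-neg v)

Xor-cong : ∀ {A A′ B B′ : Set} → A ⇔ A′ → B ⇔ B′ → Xor A B ⇔ Xor A′ B′
Xor-cong A⇔A′ B⇔B′ = mk⇔ (transport A⇔A′ B⇔B′) (transport (⇔.sym A⇔A′) (⇔.sym B⇔B′))
  where
  open Equivalence
  transport : ∀ {A A′ B B′ : Set} → A ⇔ A′ → B ⇔ B′ → Xor A B → Xor A′ B′
  transport A⇔A′ B⇔B′ = Sum.map (Product.map (to A⇔A′) (λ ¬b b′ → ¬b (from B⇔B′ b′)))
                                (Product.map (to B⇔B′) (λ ¬a a′ → ¬a (from A⇔A′ a′)))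

Xor-opposite : ∀ s x → Xor (s ≡ x) (opposite s ≡ x)
Xor-opposite Sign.+ Sign.+ = inj₁ (refl , λ ())
Xor-opposite Sign.+ Sign.- = inj₂ (refl , λ ())
Xor-opposite Sign.- Sign.+ = inj₂ (refl , λ ())
Xor-opposite Sign.- Sign.- = inj₁ (refl , λ ())

-- A choice c keeps, of the antipodal pair ±(ε₀ + t·ε_{i+1}), the root with leading sign c t.
Choice : Set
Choice = Sign → Sign

chosen : Choice → Fin m → Sign → ℤVec (suc m)
chosen c i t = leadRoot (c t) (c t Sign.* t) i

shiftTail : ℤVec (suc m) → ℤVec (suc (suc m))
shiftTail (x ∷ v) = x ∷ 0ℤ ∷ v

leadRoots : Vec Choice m → List (ℤVec (suc m))
leadRoots [] = []
leadRoots (c ∷ cs) = (chosen c zero Sign.+ ∷ chosen c zero Sign.- ∷ []) ++ map shiftTail (leadRoots cs)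

∈-leadRoots⁻ : (cs : Vec Choice m) → ∀ {x} → x ∈ leadRoots cs → ∃₂ λ i t → x ≡ chosen (lookup cs i) i t
∈-leadRoots⁻ (c ∷ cs) (here refl) = zero , Sign.+ , refl
∈-leadRoots⁻ (c ∷ cs) (there (here refl)) = zero , Sign.- , refl
∈-leadRoots⁻ (c ∷ cs) (there (there x∈)) with ∈-map⁻ shiftTail x∈
... | y , y∈ , refl with ∈-leadRoots⁻ cs y∈
... | i , t , refl = suc i , t , refl

∈-leadRoots⁺ : (cs : Vec Choice m) → ∀ i t → chosen (lookup cs i) i t ∈ leadRoots cs
∈-leadRoots⁺ (c ∷ cs) zero Sign.+ = here refl
∈-leadRoots⁺ (c ∷ cs) zero Sign.- = there (here refl)
∈-leadRoots⁺ (c ∷ cs) (suc i) t = there (there (∈-map⁺ shiftTail (∈-leadRoots⁺ cs i t)))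

opposite*opposite : ∀ s u → opposite s Sign.* opposite u ≡ s Sign.* u
opposite*opposite Sign.+ u = Sign.opposite-involutive u
opposite*opposite Sign.- u = refl

s*[s*t]≡t : ∀ s t → s Sign.* (s Sign.* t) ≡ t
s*[s*t]≡t s t = trans (sym (Sign.*-assoc s s t)) (cong (Sign._* t) (Sign.s*s≡+ s))

leadRoot∈leadRoots⇔ : (cs : Vec Choice m) → ∀ s u i → leadRoot s u i ∈ leadRoots cs ⇔ s ≡ lookup cs i (s Sign.* u)
leadRoot∈leadRoots⇔ cs s u i = mk⇔ to from
  where
  to : leadRoot s u i ∈ leadRoots cs → s ≡ lookup cs i (s Sign.* u)
  to l∈ with ∈-leadRoots⁻ cs l∈
  ... | j , t , e with leadRoot-injective e
  ... | refl , refl , refl = cong (lookup cs i) (sym (s*[s*t]≡t s t))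
  from : s ≡ lookup cs i (s Sign.* u) → leadRoot s u i ∈ leadRoots cs
  from s≡ = subst (_∈ leadRoots cs) chosen≡lead (∈-leadRoots⁺ cs i (s Sign.* u))
    where
    chosen≡lead : chosen (lookup cs i) i (s Sign.* u) ≡ leadRoot s u i
    chosen≡lead rewrite sym s≡ = cong (λ u′ → leadRoot s u′ i) (s*[s*t]≡t s u)

shiftTail-injective : ∀ {x y : ℤVec (suc m)} → shiftTail x ≡ shiftTail y → x ≡ y
shiftTail-injective {x = _ ∷ _} {_ ∷ _} e with ∷-injective e
... | x₀≡y₀ , tl = cong₂ _∷_ x₀≡y₀ (∷-injectiveʳ tl)

chosen-injective : ∀ c (i : Fin m) {t t′} → chosen c i t ≡ chosen c i t′ → t ≡ t′
chosen-injective c i {t} {t′} e with leadRoot-injective e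
... | ct≡ct′ , ct*t≡ , _ = Sign.*-cancelˡ-≡ (c t) t t′ (trans ct*t≡ (cong (Sign._* t′) (sym ct≡ct′)))

leadRoots-unique : (cs : Vec Choice m) → Unique (leadRoots cs)
leadRoots-unique [] = []
leadRoots-unique (c ∷ cs) = Unique.++⁺ first-column (Unique.map⁺ shiftTail-injective (leadRoots-unique cs)) disjoint
  where
  first-column : Unique (chosen c zero Sign.+ ∷ chosen c zero Sign.- ∷ [])
  first-column = ((λ e → case chosen-injective c zero e of λ ()) All.∷ All.[]) ∷ All.[] ∷ []
  disjoint : ∀ {v} → ¬ (v ∈ chosen c zero Sign.+ ∷ chosen c zero Sign.- ∷ [] × v ∈ map shiftTail (leadRoots cs))
  disjoint (v∈ , v∈′) with ∈-map⁻ shiftTail v∈′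
  ... | _ ∷ _ , _ , refl with v∈
  ... | here e = sgn≢0 (c Sign.+ Sign.* Sign.+) (sym (∷-injectiveˡ (∷-injectiveʳ e)))
  ... | there (here e) = sgn≢0 (c Sign.- Sign.* Sign.-) (sym (∷-injectiveˡ (∷-injectiveʳ e)))

leadRoot∉map-0∷ : ∀ s u (i : Fin m) {H} → ¬ (leadRoot s u i ∈ map (0ℤ ∷_) H)
leadRoot∉map-0∷ s u i l∈ with ∈-map⁻ (0ℤ ∷_) l∈
... | _ , _ , e = sgn≢0 s (∷-injectiveˡ e)

0∷∉leadRoots : (cs : Vec Choice m) → ∀ β → ¬ (0ℤ ∷ β ∈ leadRoots cs)
0∷∉leadRoots cs β 0∷β∈ with ∈-leadRoots⁻ cs 0∷β∈
... | i , t , e = sgn≢0 _ (sym (∷-injectiveˡ e))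

extend : Vec Choice m → List (ℤVec m) → List (ℤVec (suc m))
extend cs H = leadRoots cs ++ map (0ℤ ∷_) H

module _ (cs : Vec Choice m) (H : List (ℤVec m)) where

  leadRoot∈extend⇔ : ∀ s u i → leadRoot s u i ∈ extend cs H ⇔ s ≡ lookup cs i (s Sign.* u)
  leadRoot∈extend⇔ s u i = mk⇔ (to (leadRoot∈leadRoots⇔ cs s u i) ∘ from-extend) (∈-++⁺ˡ ∘ from (leadRoot∈leadRoots⇔ cs s u i))
    where
    open Equivalence
    from-extend : leadRoot s u i ∈ extend cs H → leadRoot s u i ∈ leadRoots cs
    from-extend l∈ with ∈-++⁻ (leadRoots cs) l∈
    ... | inj₁ l∈′ = l∈′
    ... | inj₂ l∈′ = ⊥-elim (leadRoot∉map-0∷ s u i l∈′)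

  0∷∈extend⇔ : ∀ β → (0ℤ ∷ β) ∈ extend cs H ⇔ β ∈ H
  0∷∈extend⇔ β = mk⇔ to (∈-++⁺ʳ (leadRoots cs) ∘ ∈-map⁺ (0ℤ ∷_))
    where
    to : (0ℤ ∷ β) ∈ extend cs H → β ∈ H
    to 0∷β∈ with ∈-++⁻ (leadRoots cs) 0∷β∈
    ... | inj₁ 0∷β∈′ = ⊥-elim (0∷∉leadRoots cs β 0∷β∈′)
    ... | inj₂ 0∷β∈′ with ∈-map⁻ (0ℤ ∷_) 0∷β∈′
    ... | γ , γ∈ , e = subst (_∈ H) (sym (∷-injectiveʳ e)) γ∈

  extend-isHalf : IsHalf m H → IsHalf (suc m) (extend cs H)
  extend-isHalf (H-unique , H⊆D , H-complete) = unique , ⊆D , complete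
    where
    unique : Unique (extend cs H)
    unique = Unique.++⁺ (leadRoots-unique cs) (Unique.map⁺ ∷-injectiveʳ H-unique)
                        (λ (v∈ , v∈′) → disjoint v∈ v∈′)
      where
      disjoint : ∀ {v} → v ∈ leadRoots cs → ¬ (v ∈ map (0ℤ ∷_) H)
      disjoint v∈ v∈′ with ∈-map⁻ (0ℤ ∷_) v∈′
      ... | β , _ , refl = 0∷∉leadRoots cs β v∈
    ⊆D : All (InD (suc m)) (extend cs H)
    ⊆D = All.++⁺ (All.tabulate root) (All.map⁺ (All.map InD-tail H⊆D))
      where
      root : ∀ {x} → x ∈ leadRoots cs → InD (suc m) x
      root x∈ with ∈-leadRoots⁻ cs x∈
      ... | i , t , refl = InD-leadRoot _ _ i
    complete : ∀ α → InD (suc m) α → Xor (α ∈ extend cs H) (neg α ∈ extend cs H)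
    complete α d with rootView d
    ... | isLead s u i rewrite neg-leadRoot s u i =
      Equivalence.from (Xor-cong (leadRoot∈extend⇔ s u i) -leadRoot∈extend⇔) (Xor-opposite s (lookup cs i (s Sign.* u)))
      where
      -leadRoot∈extend⇔ : leadRoot (opposite s) (opposite u) i ∈ extend cs H ⇔ opposite s ≡ lookup cs i (s Sign.* u)
      -leadRoot∈extend⇔ rewrite sym (opposite*opposite s u) = leadRoot∈extend⇔ (opposite s) (opposite u) i
    ... | isTail {β} dβ =
      Equivalence.from (Xor-cong (0∷∈extend⇔ β) (0∷∈extend⇔ (neg β))) (H-complete β dβ)

vsum-++ : (xs ys : List (ℤVec m)) → vsum (xs ++ ys) ≡ vsum xs ⊕ vsum ys
vsum-++ [] ys = sym (⊕-identityˡ (vsum ys))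
vsum-++ (x ∷ xs) ys = trans (cong (x ⊕_) (vsum-++ xs ys)) (sym (⊕-assoc x (vsum xs) (vsum ys)))

vsum-map-0∷ : (H : List (ℤVec m)) → vsum (map (0ℤ ∷_) H) ≡ 0ℤ ∷ vsum H
vsum-map-0∷ [] = refl
vsum-map-0∷ (x ∷ H) = cong ((0ℤ ∷ x) ⊕_) (vsum-map-0∷ H)

vsum-map-shiftTail : (xs : List (ℤVec (suc m))) → vsum (map shiftTail xs) ≡ shiftTail (vsum xs)
vsum-map-shiftTail [] = refl
vsum-map-shiftTail (x ∷ xs) = trans (cong (shiftTail x ⊕_) (vsum-map-shiftTail xs)) (shiftTail-⊕ x (vsum xs))
  where
  shiftTail-⊕ : ∀ (x y : ℤVec (suc m)) → shiftTail x ⊕ shiftTail y ≡ shiftTail (x ⊕ y)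
  shiftTail-⊕ (_ ∷ _) (_ ∷ _) = refl

headSum tailSum : Choice → ℤ
headSum c = sgn (c Sign.+) + sgn (c Sign.-)
tailSum c = sgn (c Sign.+ Sign.* Sign.+) + sgn (c Sign.- Sign.* Sign.-)

vsum-leadRoots : (cs : Vec Choice m) → vsum (leadRoots cs) ≡ coordSum (Vec.map headSum cs) ∷ Vec.map tailSum cs
vsum-leadRoots [] = refl
vsum-leadRoots {suc m} (c ∷ cs) = begin
  chosen c zero Sign.+ ⊕ (chosen c zero Sign.- ⊕ vsum (map shiftTail (leadRoots cs)))
    ≡⟨ cong (λ v → chosen c zero Sign.+ ⊕ (chosen c zero Sign.- ⊕ v))
            (trans (vsum-map-shiftTail (leadRoots cs)) (cong shiftTail (vsum-leadRoots cs))) ⟩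
  (sgn (c Sign.+) + (sgn (c Sign.-) + X)) ∷ (p + (q + 0ℤ)) ∷ (𝟎 ⊕ (𝟎 ⊕ V))
    ≡⟨ cong₂ _∷_ (sym (ℤ.+-assoc (sgn (c Sign.+)) (sgn (c Sign.-)) X))
                 (cong₂ _∷_ (cong (_+_ p) (ℤ.+-identityʳ q)) (trans (⊕-identityˡ _) (⊕-identityˡ V))) ⟩
  (headSum c + X) ∷ tailSum c ∷ V ∎
  where
  open ≡-Reasoning
  X = coordSum (Vec.map headSum cs)
  V = Vec.map tailSum cs
  p = sgn (c Sign.+ Sign.* Sign.+)
  q = sgn (c Sign.- Sign.* Sign.-)

vsum-extend : (cs : Vec Choice m) (H : List (ℤVec m)) →
  vsum (extend cs H) ≡ (coordSum (Vec.map headSum cs) ∷ Vec.map tailSum cs) ⊕ (0ℤ ∷ vsum H)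
vsum-extend cs H = trans (vsum-++ (leadRoots cs) (map (0ℤ ∷_) H))
                         (cong₂ _⊕_ (vsum-leadRoots cs) (vsum-map-0∷ H))

vsum-extend-balanced : (cs : Vec Choice m) {H : List (ℤVec m)} {v : ℤVec m} →
  coordSum (Vec.map headSum cs) ≡ 0ℤ → vsum H ≡ v → vsum (extend cs H) ≡ 0ℤ ∷ (Vec.map tailSum cs ⊕ v)
vsum-extend-balanced cs {H} balanced refl rewrite vsum-extend cs H | balanced = refl

-- An extension adds the tail sums of its choices to the running sum shifted by one place;
-- with these choices the running sums are (0,2,…,2), (0,2,0,…,0), (0,2,0,2,…,2) and 0.
module _ (m : ℕ) where

  choices₁ : Vec Choice m
  choices₁ = replicate m id

  choices₂ : Vec Choice (suc m)
  choices₂ = id ∷ replicate m opposite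

  choices₃ : Vec Choice (2 ℕ.+ m)
  choices₃ = id ∷ opposite ∷ replicate m id

  choices₄ : Vec Choice (3 ℕ.+ m)
  choices₄ = const Sign.- ∷ opposite ∷ const Sign.+ ∷ replicate m opposite

  headSums-replicate : ∀ c → headSum c ≡ 0ℤ → coordSum (Vec.map headSum (replicate m c)) ≡ 0ℤ
  headSums-replicate c hc rewrite map-replicate headSum c m | hc = coordSum-𝟎 m

extend⁴ : List (ℤVec m) → List (ℤVec (4 ℕ.+ m))
extend⁴ {m} H = extend (choices₄ m) (extend (choices₃ m) (extend (choices₂ m) (extend (choices₁ m) H)))

extend⁴-isHalf : {H : List (ℤVec m)} → IsHalf m H → IsHalf (4 ℕ.+ m) (extend⁴ H)
extend⁴-isHalf {m} {H} hH =
  extend-isHalf (choices₄ m) _ (extend-isHalf (choices₃ m) _ (extend-isHalf (choices₂ m) _ (extend-isHalf (choices₁ m) H hH)))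

extend⁴-sum : {H : List (ℤVec m)} → vsum H ≡ 𝟎 → vsum (extend⁴ H) ≡ 𝟎
extend⁴-sum {m} sH =
  trans (vsum-extend-balanced (choices₄ m) bal₄
          (vsum-extend-balanced (choices₃ m) bal₃
            (vsum-extend-balanced (choices₂ m) bal₂
              (vsum-extend-balanced (choices₁ m) bal₁ sH))))
        columns-cancel
  where
  bal₁ : coordSum (Vec.map headSum (choices₁ m)) ≡ 0ℤ
  bal₁ = headSums-replicate m id refl
  bal₂ : coordSum (Vec.map headSum (choices₂ m)) ≡ 0ℤ
  bal₂ rewrite headSums-replicate m opposite refl = refl
  bal₃ : coordSum (Vec.map headSum (choices₃ m)) ≡ 0ℤ
  bal₃ rewrite headSums-replicate m id refl = refl
  bal₄ : coordSum (Vec.map headSum (choices₄ m)) ≡ 0ℤ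
  bal₄ rewrite headSums-replicate m opposite refl = refl
  tail-cancel : ∀ m → replicate m (-[1+ 1 ]) ⊕ (replicate m (+ 2) ⊕ (replicate m (-[1+ 1 ]) ⊕ (replicate m (+ 2) ⊕ 𝟎))) ≡ 𝟎
  tail-cancel zero = refl
  tail-cancel (suc m) = cong (0ℤ ∷_) (tail-cancel m)
  columns-cancel : 0ℤ ∷ (Vec.map tailSum (choices₄ m) ⊕ (0ℤ ∷ (Vec.map tailSum (choices₃ m) ⊕ (0ℤ ∷
                     (Vec.map tailSum (choices₂ m) ⊕ (0ℤ ∷ (Vec.map tailSum (choices₁ m) ⊕ 𝟎))))))) ≡ 𝟎
  columns-cancel rewrite map-replicate tailSum id m | map-replicate tailSum opposite m =
    cong (λ v → 0ℤ ∷ 0ℤ ∷ 0ℤ ∷ 0ℤ ∷ v) (tail-cancel m)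

weight : ℤVec n → ℕ
weight α = ∣ coordSum α ∣

weight-neg : (v : ℤVec n) → weight (neg v) ≡ weight v
weight-neg v = trans (cong ∣_∣ (coordSum-neg v)) (ℤ.∣-i∣≡∣i∣ (coordSum v))

weight-0∷ : (v : ℤVec n) → weight (0ℤ ∷ v) ≡ weight v
weight-0∷ v = cong ∣_∣ (ℤ.+-identityˡ (coordSum v))

weight-shiftTail : (v : ℤVec (suc n)) → weight (shiftTail v) ≡ weight v
weight-shiftTail (x ∷ v) = cong (λ z → ∣ x + z ∣) (ℤ.+-identityˡ (coordSum v))

weight-leadRoot : ∀ s u (i : Fin m) → weight (leadRoot s u i) ≡ ∣ sgn s + sgn u ∣
weight-leadRoot s u i = cong ∣_∣ (coordSum-leadRoot s u i)

weight-chosen-+ : ∀ c (i : Fin m) → weight (chosen c i Sign.+) ≡ 2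
weight-chosen-+ c i = trans (weight-leadRoot (c Sign.+) _ i) (∣sgn-s+sgn-s∣≡2 (c Sign.+))
  where
  ∣sgn-s+sgn-s∣≡2 : ∀ s → ∣ sgn s + sgn (s Sign.* Sign.+) ∣ ≡ 2
  ∣sgn-s+sgn-s∣≡2 Sign.+ = refl
  ∣sgn-s+sgn-s∣≡2 Sign.- = refl

weight-chosen-- : ∀ c (i : Fin m) → weight (chosen c i Sign.-) ≡ 0
weight-chosen-- c i = trans (weight-leadRoot (c Sign.-) _ i) (∣sgn-s-sgn-s∣≡0 (c Sign.-))
  where
  ∣sgn-s-sgn-s∣≡0 : ∀ s → ∣ sgn s + sgn (s Sign.* Sign.-) ∣ ≡ 0
  ∣sgn-s-sgn-s∣≡0 Sign.+ = refl
  ∣sgn-s-sgn-s∣≡0 Sign.- = refl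

weight-leadRoots : (cs : Vec Choice m) → sum (map weight (leadRoots cs)) ≡ 2 * m
weight-leadRoots [] = refl
weight-leadRoots {suc m} (c ∷ cs) = begin
  weight (chosen c (zero {m}) Sign.+) ℕ.+ (weight (chosen c (zero {m}) Sign.-) ℕ.+ sum (map weight (map shiftTail (leadRoots cs))))
    ≡⟨ cong₂ ℕ._+_ (weight-chosen-+ c (zero {m})) (cong₂ ℕ._+_ (weight-chosen-- c (zero {m}))
         (trans (sum-map-∘ weight shiftTail weight-shiftTail (leadRoots cs)) (weight-leadRoots cs))) ⟩
  2 ℕ.+ 2 * m
    ≡⟨ ℕ.*-suc 2 m ⟨
  2 * suc m ∎
  where open ≡-Reasoning

weight-extend : (cs : Vec Choice m) (H : List (ℤVec m)) →
  sum (map weight (extend cs H)) ≡ 2 * m ℕ.+ sum (map weight H)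
weight-extend {m} cs H = begin
  sum (map weight (leadRoots cs ++ map (0ℤ ∷_) H))
    ≡⟨ cong sum (List.map-++ weight (leadRoots cs) (map (0ℤ ∷_) H)) ⟩
  sum (map weight (leadRoots cs) ++ map weight (map (0ℤ ∷_) H))
    ≡⟨ sum-++ (map weight (leadRoots cs)) _ ⟩
  sum (map weight (leadRoots cs)) ℕ.+ sum (map weight (map (0ℤ ∷_) H))
    ≡⟨ cong₂ ℕ._+_ (weight-leadRoots cs) (sum-map-∘ weight (0ℤ ∷_) weight-0∷ H) ⟩
  2 * m ℕ.+ sum (map weight H) ∎
  where open ≡-Reasoning

someHalf : ∀ n → List (ℤVec n)
someHalf ℕ.zero = []
someHalf (suc m) = extend (choices₁ m) (someHalf m)

someHalf-isHalf : ∀ n → IsHalf n (someHalf n)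
someHalf-isHalf ℕ.zero = [] , [] , λ _ d → ⊥-elim (InD-0-empty d)
someHalf-isHalf (suc m) = extend-isHalf (choices₁ m) (someHalf m) (someHalf-isHalf m)

suc-C2 : ∀ n → suc n C 2 ≡ n ℕ.+ n C 2
suc-C2 n = trans (sym (nCk+nC[k+1]≡[n+1]C[k+1] n 1)) (cong (ℕ._+ n C 2) (nC1≡n n))

someHalf-weight : ∀ n → sum (map weight (someHalf n)) ≡ 2 * (n C 2)
someHalf-weight ℕ.zero = refl
someHalf-weight (suc m) = begin
  sum (map weight (extend (choices₁ m) (someHalf m))) ≡⟨ weight-extend (choices₁ m) (someHalf m) ⟩
  2 * m ℕ.+ sum (map weight (someHalf m))             ≡⟨ cong (2 * m ℕ.+_) (someHalf-weight m) ⟩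
  2 * m ℕ.+ 2 * (m C 2)                               ≡⟨ ℕ.*-distribˡ-+ 2 m (m C 2) ⟨
  2 * (m ℕ.+ m C 2)                                   ≡⟨ cong (2 *_) (suc-C2 m) ⟨
  2 * (suc m C 2)                                     ∎
  where open ≡-Reasoning

half-weight : {H : List (ℤVec n)} → IsHalf n H → sum (map weight H) ≡ 2 * (n C 2)
half-weight {n} hH = trans (half-weight-invariant InD⇒≢𝟎 weight weight-neg hH (someHalf-isHalf n)) (someHalf-weight n)

_⁺ _⁻ : ℤ → ℕ
(+ k) ⁺ = k
-[1+ _ ] ⁺ = 0
(+ _) ⁻ = 0
-[1+ k ] ⁻ = suc k

∣z∣≡z⁺+z⁻ : ∀ z → ∣ z ∣ ≡ z ⁺ ℕ.+ z ⁻
∣z∣≡z⁺+z⁻ (+ k) = sym (ℕ.+-identityʳ k)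
∣z∣≡z⁺+z⁻ -[1+ k ] = refl

z≡z⁺-z⁻ : ∀ z → z ≡ + z ⁺ - + z ⁻
z≡z⁺-z⁻ (+ k) = sym (ℤ.+-identityʳ (+ k))
z≡z⁺-z⁻ -[1+ k ] = refl

positivePart negativePart : List (ℤVec n) → ℕ
positivePart H = sum (map (λ α → coordSum α ⁺) H)
negativePart H = sum (map (λ α → coordSum α ⁻) H)

weight-split : (H : List (ℤVec n)) → sum (map weight H) ≡ positivePart H ℕ.+ negativePart H
weight-split [] = refl
weight-split (x ∷ H) = trans (cong₂ ℕ._+_ (∣z∣≡z⁺+z⁻ (coordSum x)) (weight-split H))
                             (ℕ-interchange (coordSum x ⁺) (coordSum x ⁻) (positivePart H) (negativePart H))

coordSum-vsum : (H : List (ℤVec n)) → coordSum (vsum H) ≡ + positivePart H - + negativePart H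
coordSum-vsum {n} [] = coordSum-𝟎 n
coordSum-vsum (x ∷ H) = begin
  coordSum (x ⊕ vsum H)                    ≡⟨ coordSum-⊕ x (vsum H) ⟩
  coordSum x + coordSum (vsum H)           ≡⟨ cong₂ _+_ (z≡z⁺-z⁻ (coordSum x)) (coordSum-vsum H) ⟩
  (+ a - + b) + (+ P - + N)                ≡⟨ regroup (+ a) (+ b) (+ P) (+ N) ⟩
  (+ a + + P) - (+ b + + N)                ≡⟨ cong₂ _-_ (ℤ.pos-+ a P) (ℤ.pos-+ b N) ⟨
  + (a ℕ.+ P) - + (b ℕ.+ N)                ∎
  where
  open ≡-Reasoning
  a = coordSum x ⁺
  b = coordSum x ⁻
  P = positivePart H
  N = negativePart H
  regroup : ∀ p q r s → (p - q) + (r - s) ≡ (p + r) - (q + s)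
  regroup = ℤ-Solver.solve-∀

zeroSum⇒balanced : {H : List (ℤVec n)} → vsum H ≡ 𝟎 → positivePart H ≡ negativePart H
zeroSum⇒balanced {n} {H} vsum≡𝟎 = ℤ.+-injective (ℤ.i-j≡0⇒i≡j _ _
  (trans (sym (coordSum-vsum H)) (trans (cong coordSum vsum≡𝟎) (coordSum-𝟎 n))))

root-positivePart-even : ∀ {α} → InD n α → 2 ∣ coordSum α ⁺
root-positivePart-even {suc n} d with rootView d
... | isLead s u i rewrite coordSum-leadRoot s u i = even s u
  where
  even : ∀ s u → 2 ∣ (sgn s + sgn u) ⁺
  even Sign.+ Sign.+ = ∣-refl
  even Sign.+ Sign.- = 2 ∣0
  even Sign.- Sign.+ = 2 ∣0
  even Sign.- Sign.- = 2 ∣0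
... | isTail {β} dβ rewrite ℤ.+-identityˡ (coordSum β) = root-positivePart-even dβ

positivePart-even : {H : List (ℤVec n)} → All (InD n) H → 2 ∣ positivePart H
positivePart-even [] = 2 ∣0
positivePart-even (dx ∷ dH) = ∣m∣n⇒∣m+n (root-positivePart-even dx) (positivePart-even dH)

zeroSumHalf⇒even-C2 : {H : List (ℤVec n)} → IsHalf n H → vsum H ≡ 𝟎 → 2 ∣ n C 2
zeroSumHalf⇒even-C2 {n} {H} hH@(_ , H⊆D , _) vsum≡𝟎 = subst (2 ∣_) (sym C2≡P) (positivePart-even H⊆D)
  where
  open ≡-Reasoning
  P = positivePart H
  C2≡P : n C 2 ≡ P
  C2≡P = ℕ.*-cancelˡ-≡ (n C 2) P 2 (begin
    2 * (n C 2)                       ≡⟨ half-weight hH ⟨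
    sum (map weight H)                ≡⟨ weight-split H ⟩
    P ℕ.+ negativePart H              ≡⟨ cong (P ℕ.+_) (zeroSum⇒balanced {H = H} vsum≡𝟎) ⟨
    P ℕ.+ P                           ≡⟨ cong (P ℕ.+_) (ℕ.+-identityʳ P) ⟨
    2 * P                             ∎)

ZeroSumHalf : ℕ → Set
ZeroSumHalf n = Σ (List (ℤVec n)) (λ H → IsHalf n H × vsum H ≡ 𝟎)

ZeroOrOne : ℕ → Set
ZeroOrOne r = (r ≡ 0) ⊎ (r ≡ 1)

[4+n]%4≡n%4 : ∀ n → (4 ℕ.+ n) % 4 ≡ n % 4
[4+n]%4≡n%4 n = trans (cong (_% 4) (ℕ.+-comm 4 n)) ([m+n]%n≡m%n n 4)

[4+n]C2 : ∀ n → (4 ℕ.+ n) C 2 ≡ 2 * (3 ℕ.+ 2 * n) ℕ.+ n C 2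
[4+n]C2 n = trans unfold-C2 (regroup n (n C 2))
  where
  unfold-C2 : (4 ℕ.+ n) C 2 ≡ (3 ℕ.+ n) ℕ.+ ((2 ℕ.+ n) ℕ.+ ((1 ℕ.+ n) ℕ.+ (n ℕ.+ n C 2)))
  unfold-C2 =
    trans (suc-C2 (3 ℕ.+ n)) (cong ((3 ℕ.+ n) ℕ.+_)
    (trans (suc-C2 (2 ℕ.+ n)) (cong ((2 ℕ.+ n) ℕ.+_)
    (trans (suc-C2 (1 ℕ.+ n)) (cong ((1 ℕ.+ n) ℕ.+_) (suc-C2 n))))))
  regroup : ∀ n c → (3 ℕ.+ n) ℕ.+ ((2 ℕ.+ n) ℕ.+ ((1 ℕ.+ n) ℕ.+ (n ℕ.+ c))) ≡ 2 * (3 ℕ.+ 2 * n) ℕ.+ c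
  regroup = ℕ-Solver.solve-∀

even-C2⇒mod4 : ∀ n → 2 ∣ n C 2 → ZeroOrOne (n % 4)
even-C2⇒mod4 0 _ = inj₁ refl
even-C2⇒mod4 1 _ = inj₂ refl
even-C2⇒mod4 2 2∣1 with () ← n∣m⇒m%n≡0 1 2 2∣1
even-C2⇒mod4 3 2∣3 with () ← n∣m⇒m%n≡0 3 2 2∣3
even-C2⇒mod4 (suc (suc (suc (suc n)))) 2∣C2 =
  subst ZeroOrOne (sym ([4+n]%4≡n%4 n))
    (even-C2⇒mod4 n (∣m+n∣m⇒∣n (subst (2 ∣_) ([4+n]C2 n) 2∣C2) (m∣m*n (3 ℕ.+ 2 * n))))

zeroSumHalf : ∀ n → ZeroOrOne (n % 4) → ZeroSumHalf n
zeroSumHalf 0 _ = [] , someHalf-isHalf 0 , refl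
zeroSumHalf 1 _ = [] , someHalf-isHalf 1 , refl
zeroSumHalf 2 (inj₁ ())
zeroSumHalf 2 (inj₂ ())
zeroSumHalf 3 (inj₁ ())
zeroSumHalf 3 (inj₂ ())
zeroSumHalf (suc (suc (suc (suc n)))) r with zeroSumHalf n (subst ZeroOrOne ([4+n]%4≡n%4 n) r)
... | H , hH , vsum≡𝟎 = extend⁴ H , extend⁴-isHalf hH , extend⁴-sum vsum≡𝟎

proposition2p2 : (n : ℕ) → 4 ≤ n →
    (Σ (List (ℤVec n)) (λ H → IsHalf n H × vsum H ≡ 𝟎)) ⇔ ((n % 4 ≡ 0) ⊎ (n % 4 ≡ 1))
proposition2p2 n _ = mk⇔ (λ (H , hH , vsum≡𝟎) → even-C2⇒mod4 n (zeroSumHalf⇒even-C2 hH vsum≡𝟎)) (zeroSumHalf n)
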